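{- The approximation ratio of any greedy-like algorithm for the Maximum Independent Set problem in graphs with degree at most $\Delta$ is at least $\frac{\Delta+1}{3}-O(1/\Delta)$. That is, there is an absolute constant $c>0$ such that for every integer $\Delta\ge 1$ and every algorithm $A$ (with arbitrary, even exponential-time, rules for choosing among minimum degree vertices) that on each graph $G$ outputs a greedy set $A(G)$ of $G$, $$\sup_{G}\frac{\alpha(G)}{|A(G)|}\ \ge\ \frac{\Delta+1}{3}-\frac{c}{\Delta},$$ where the supremum is over all nonempty graphs $G$ with maximum degree at most $\Delta$.
   Context: Graphs are finite, simple and undirected; $\alpha(G)$ is the maximum size of an independent set of $G$; $N_G[S]$ is the closed neighbourhood of a vertex set $S$. A set $I\subseteq V(G)$ is a greedy set of $G=(V,E)$ if it is a possible output of the minimum-degree greedy algorithm: the elements of $I$ can be ordered $v_1,\dots,v_k$ so that for each $1\le i\le k$ the vertex $v_i$ belongs to and has minimum degree in $G_i:=G[V\setminus N_G[\{v_1,\dots,v_{i-1}\}]]$, and $N_G[I]=V$. -}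

module Defs where

open import Level using (0ℓ)
open import Data.Empty using (⊥-elim)
open import Data.Nat as ℕ using (ℕ; zero; suc; NonZero; z≤n)
import Data.Nat.Properties as ℕ
open import Data.Integer using (+_)
open import Data.Rational using (ℚ; _<_; _/_)
open import Data.Fin as Fin using (Fin)
open import Data.Fin.Properties using (any?; all?; _≟_; _<?_)
open import Data.Fin.Subset using (Subset; _∈_; _∩_; ∁; ∣_∣; ⊥; Nonempty)
open import Data.Fin.Subset.Properties
  using (_∈?_; anySubset?; ∉⊥; ∣⊥∣≡0; ∣p∣≤n; x∈p⇒∣p-x∣<∣p∣)
open import Data.Product using (∃; ∃-syntax; _×_; _,_; proj₁; proj₂)
open import Data.Sum using (inj₁; inj₂)
open import Data.Vec using (tabulate)
open import Data.Vec.Properties using (lookup∘tabulate; []=⇒lookup)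
open import Function using (_∘_; _⇔_)
open import Function.Definitions using (Injective)
open import Relation.Binary using (Rel; Symmetric; Irreflexive; Decidable)
open import Relation.Binary.PropositionalEquality using (_≡_; sym; trans)
open import Relation.Nullary using (¬_; yes; no; does)
open import Relation.Nullary.Decidable using (_×-dec_; _⊎-dec_; _→-dec_; ¬?)
import Relation.Unary as Unary

record Graph : Set₁ where
  infix 4 _~_ _~?_
  field
    order    : ℕ
    _~_      : Rel (Fin order) 0ℓ
    _~?_     : Decidable _~_
    ~-sym    : Symmetric _~_
    ~-irrefl : Irreflexive _≡_ _~_

  Vertex : Set
  Vertex = Fin order

  VertexSet : Set
  VertexSet = Subset order

⟦_⟧ : ∀ {n p} {P : Unary.Pred (Fin n) p} → Unary.Decidable P → Subset n
⟦ P? ⟧ = tabulate (does ∘ P?)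

∈⟦⟧⁻ : ∀ {n p} {P : Unary.Pred (Fin n) p} (P? : Unary.Decidable P) {x} →
       x ∈ ⟦ P? ⟧ → P x
∈⟦⟧⁻ P? {x} x∈ with P? x | trans (sym (lookup∘tabulate (does ∘ P?) x)) ([]=⇒lookup x∈)
... | yes px | _  = px
... | no _   | ()

module _ (G : Graph) where
  open Graph G

  neighbours : Vertex → VertexSet
  neighbours v = ⟦ (v ~?_) ⟧

  N[_] : VertexSet → VertexSet
  N[ S ] = ⟦ (λ w → (w ∈? S) ⊎-dec any? (λ v → (v ∈? S) ×-dec (v ~? w))) ⟧

  degree : Vertex → ℕ
  degree v = ∣ neighbours v ∣

  MaxDegree≤ : ℕ → Set
  MaxDegree≤ Δ = ∀ v → degree v ℕ.≤ Δ

  -- The degree of v in the induced subgraph G[U].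
  degreeIn : VertexSet → Vertex → ℕ
  degreeIn U v = ∣ U ∩ neighbours v ∣

  IsMinDegreeVertexIn : VertexSet → Vertex → Set
  IsMinDegreeVertexIn U v = v ∈ U × (∀ {u} → u ∈ U → degreeIn U v ℕ.≤ degreeIn U u)

  before : ∀ {k} → (Fin k → Vertex) → Fin k → VertexSet
  before v i = ⟦ (λ w → any? (λ j → (j <? i) ×-dec (v j ≟ w))) ⟧

  record IsGreedySet (I : VertexSet) : Set where
    field
      size       : ℕ
      v          : Fin size → Vertex
      injective  : Injective _≡_ _≡_ v
      enumerates : ∀ x → x ∈ I ⇔ (∃[ i ] v i ≡ x)
      greedy     : ∀ i → IsMinDegreeVertexIn (∁ N[ before v i ]) (v i)
      dominating : ∀ x → x ∈ N[ I ]

  IsIndependent : VertexSet → Set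
  IsIndependent S = ∀ u v → u ∈ S → v ∈ S → ¬ u ~ v

  isIndependent? : Unary.Decidable IsIndependent
  isIndependent? S =
    all? λ u → all? λ v → (u ∈? S) →-dec ((v ∈? S) →-dec ¬? (u ~? v))

  IsIndependenceNumber : ℕ → Set
  IsIndependenceNumber a =
    (∃[ S ] IsIndependent S × ∣ S ∣ ≡ a) × (∀ S → IsIndependent S → ∣ S ∣ ℕ.≤ a)

  independenceNumberBelow : ∀ m → (∀ S → IsIndependent S → ∣ S ∣ ℕ.≤ m) →
                            ∃ IsIndependenceNumber
  independenceNumberBelow zero bound =
    zero , (⊥ , (λ _ _ u∈⊥ → ⊥-elim (∉⊥ u∈⊥)) , ∣⊥∣≡0 order) , bound
  independenceNumberBelow (suc m) bound
    with anySubset? (λ S → isIndependent? S ×-dec (∣ S ∣ ℕ.≟ suc m))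
  ... | yes found = suc m , found , bound
  ... | no ¬found = independenceNumberBelow m λ S ind →
          ℕ.≤-pred (ℕ.≤∧≢⇒< (bound S ind) (λ eq → ¬found (S , ind , eq)))

  α : ℕ
  α = proj₁ (independenceNumberBelow order (λ S _ → ∣p∣≤n S))

  α-isIndependenceNumber : IsIndependenceNumber α
  α-isIndependenceNumber = proj₂ (independenceNumberBelow order (λ S _ → ∣p∣≤n S))

  greedy-nonempty : NonZero order → ∀ {I} → IsGreedySet I → Nonempty I
  greedy-nonempty nz {I} g
    with ∈⟦⟧⁻ (λ w → (w ∈? I) ⊎-dec any? (λ v → (v ∈? I) ×-dec (v ~? w)))
              (IsGreedySet.dominating g (Fin.fromℕ< (ℕ.>-nonZero⁻¹ order {{nz}})))
  ... | inj₁ x∈I           = _ , x∈I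
  ... | inj₂ (v , v∈I , _) = v , v∈I

  greedy-size-nonZero : NonZero order → ∀ {I} → IsGreedySet I → NonZero ∣ I ∣
  greedy-size-nonZero nz g =
    ℕ.>-nonZero (ℕ.≤-<-trans z≤n (x∈p⇒∣p-x∣<∣p∣ (proj₂ (greedy-nonempty nz g))))

-- No computability or complexity restriction: the output may depend on the
-- whole labelled graph.
record GreedyAlgorithm : Set₁ where
  field
    output : (G : Graph) → Subset (Graph.order G)
    greedy : (G : Graph) → IsGreedySet G (output G)

record NonemptyGraphOfMaxDegree≤ (Δ : ℕ) : Set₁ where
  field
    graph     : Graph
    nonempty  : NonZero (Graph.order graph)
    maxDegree : MaxDegree≤ graph Δ

ratio : GreedyAlgorithm → ∀ {Δ} → NonemptyGraphOfMaxDegree≤ Δ → ℚ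
ratio A H = ((+ α graph) / ∣ output graph ∣)
              {{greedy-size-nonZero graph nonempty (greedy graph)}}
  where
  open GreedyAlgorithm A
  open NonemptyGraphOfMaxDegree≤ H

-- x ≤sup f says that x ≤ sup f in the extended reals, without asserting that
-- the supremum exists as a rational or is attained.
infix 4 _≤sup_
_≤sup_ : ∀ {ℓ} {I : Set ℓ} → ℚ → (I → ℚ) → Set ℓ
x ≤sup f = ∀ q → q < x → ∃[ i ] q < f i

{-# OPTIONS --safe #-}

module Submission where

open import Defs
open import Level using (0ℓ)
open import Data.Empty using (⊥)
open import Data.Nat as ℕ using (ℕ; zero; suc; NonZero; z≤n; s≤s; _+_; _*_; _∸_; _≤_; _<_)
import Data.Nat.Properties as ℕ
open import Data.Nat.DivMod using (_divMod_; result)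
open import Data.Nat.Induction using (<-rec)
open import Data.Nat.Solver using (module +-*-Solver)
open import Data.Integer as ℤ using (+_)
import Data.Integer.Properties as ℤ
open import Data.Rational as ℚ using (ℚ; 0ℚ; _/_; _-_; toℚᵘ)
import Data.Rational.Properties as ℚ
open import Data.Rational.Unnormalised as ℚᵘ using (mkℚᵘ; *≤*)
import Data.Rational.Unnormalised.Properties as ℚᵘ
open import Data.Fin as Fin
  using (Fin; zero; suc; toℕ; fromℕ<; inject₁; inject≤; punchIn; punchOut; splitAt; join;
         _↑ˡ_; _↑ʳ_; remQuot; combine)
open import Data.Fin.Properties as Fin
  using (toℕ<n; toℕ-fromℕ<; toℕ-injective; injective⇒≤; punchIn-injective; punchInᵢ≢i;
         punchIn-punchOut; remQuot-combine; combine-remQuot)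
open import Data.Fin.Subset using (Subset; inside; outside; _∈_; ∁; ∣_∣)
open import Data.Fin.Subset.Properties
  using (_∈?_; x∈∁p⇒x∉p; x∉p⇒x∈∁p; x∈p∩q⁺; x∈p∩q⁻)
open import Data.Vec using ([]; _∷_; here; there)
open import Data.Vec.Properties using (lookup∘tabulate; lookup⇒[]=)
open import Data.Product using (Σ-syntax; ∃-syntax; _×_; _,_; proj₁; proj₂; uncurry)
open import Data.Product.Properties using (≡-dec)
open import Data.Sum as Sum using (_⊎_; inj₁; inj₂; [_,_])
open import Function using (_∘_; _⇔_; mk⇔; Equivalence)
open import Function.Definitions using (Injective)
open import Relation.Binary using (Rel; Decidable)
open import Relation.Binary.PropositionalEquality
  using (_≡_; _≢_; refl; sym; trans; cong; cong₂; subst; subst₂)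
open import Relation.Nullary using (¬_; Dec; yes; no; does; contradiction)
open import Relation.Nullary.Decidable using (_×-dec_; _⊎-dec_; ¬?; dec-true; from-yes)
import Relation.Unary as Unary
open import Relation.Unary using (Pred; _⊆_; _∪_)

-- For Δ + 1 = 3k + r with 1 ≤ r ≤ 3 < k, take a chain of blocks of 2k vertices, each
-- an independent set A_τ completely joined to a clique B_τ, with A_τ also completely
-- joined to B_{τ+1}; the last block is a clique. About a third of the blocks, coming
-- first, have |A_τ| = k + r, the others |A_τ| = k. Extra edges from the A-vertices of
-- the early blocks to the B-vertices of the late blocks, which have r edges to spare,
-- bring every A-vertex to degree at least 2k. When exactly the blocks before τ are gone,
-- a vertex of B_τ has degree 2k - 1, while every other remaining vertex has degree at
-- least 2k. So any greedy algorithm takes one B-vertex from each block in turn, whereas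
-- the union of the A_τ is independent, with k + r/3 - O(1/k) vertices per block.

private
  variable
    X Y : Set
    P Q : Pred X 0ℓ
    m n : ℕ

-- Records rather than Σ-types, so that P can be inferred.
record AtMost {X : Set} (P : Pred X 0ℓ) (n : ℕ) : Set where
  constructor covering
  field
    element : Fin n → X
    covers  : ∀ {x} → P x → ∃[ i ] element i ≡ x

record AtLeast {X : Set} (P : Pred X 0ℓ) (n : ℕ) : Set where
  constructor listing
  field
    element   : Fin n → X
    injective : Injective _≡_ _≡_ element
    satisfies : ∀ i → P (element i)

atLeast≤atMost : AtLeast P m → AtMost P n → m ≤ n
atLeast≤atMost (listing f f-inj f∈) (covering g g-cov) = injective⇒≤ {f = λ i → proj₁ (g-cov (f∈ i))} λ {i} {j} eq →
  f-inj (trans (sym (proj₂ (g-cov (f∈ i)))) (trans (cong g eq) (proj₂ (g-cov (f∈ j)))))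

atMost-⊆ : P ⊆ Q → AtMost Q n → AtMost P n
atMost-⊆ P⊆Q (covering f cov) = covering f λ p → cov (P⊆Q p)

atLeast-⊆ : P ⊆ Q → AtLeast P n → AtLeast Q n
atLeast-⊆ P⊆Q (listing f inj f∈) = listing f inj λ i → P⊆Q (f∈ i)

atMost-image : ∀ {P : Pred X 0ℓ} {Q : Pred Y 0ℓ} (h : X → Y) →
               (∀ {y} → Q y → ∃[ x ] P x × h x ≡ y) → AtMost P n → AtMost Q n
atMost-image h lift (covering f cov) = covering (h ∘ f) λ q →
  let x , px , hx≡y = lift q ; i , fi≡x = cov px in i , trans (cong h fi≡x) hx≡y

atLeast-image : ∀ {P : Pred X 0ℓ} {Q : Pred Y 0ℓ} {h : X → Y} →
                Injective _≡_ _≡_ h → (∀ {x} → P x → Q (h x)) → AtLeast P n → AtLeast Q n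
atLeast-image {h = h} h-inj P⇒Q (listing f f-inj f∈) =
  listing (h ∘ f) (f-inj ∘ h-inj) λ i → P⇒Q (f∈ i)

atMost-∪ : AtMost P m → AtMost Q n → AtMost (P ∪ Q) (m + n)
atMost-∪ {m = m} {n = n} (covering f f-cov) (covering g g-cov) = covering ([ f , g ] ∘ splitAt m) λ where
  (inj₁ px) → let i , eq = f-cov px in
    i ↑ˡ n , trans (cong [ f , g ] (Fin.splitAt-↑ˡ m i n)) eq
  (inj₂ qx) → let i , eq = g-cov qx in
    m ↑ʳ i , trans (cong [ f , g ] (Fin.splitAt-↑ʳ m n i)) eq

atLeast-∪ : (∀ {x} → P x → ¬ Q x) → AtLeast P m → AtLeast Q n → AtLeast (P ∪ Q) (m + n)
atLeast-∪ {P = P} {Q = Q} {m = m} {n = n} disjoint (listing f f-inj f∈) (listing g g-inj g∈) =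
  listing (h ∘ splitAt m) inj (h∈ ∘ splitAt m)
  where
  h = [ f , g ]
  h∈ : ∀ i → (P ∪ Q) (h i)
  h∈ (inj₁ i) = inj₁ (f∈ i)
  h∈ (inj₂ i) = inj₂ (g∈ i)
  h-inj : Injective _≡_ _≡_ h
  h-inj {inj₁ i} {inj₁ j} eq = cong inj₁ (f-inj eq)
  h-inj {inj₁ i} {inj₂ j} eq = contradiction (subst Q (sym eq) (g∈ j)) (disjoint (f∈ i))
  h-inj {inj₂ i} {inj₁ j} eq = contradiction (subst Q eq (g∈ i)) (disjoint (f∈ j))
  h-inj {inj₂ i} {inj₂ j} eq = cong inj₂ (g-inj eq)
  inj : Injective _≡_ _≡_ (h ∘ splitAt m)
  inj {i} {j} eq = trans (sym (Fin.join-splitAt m n i))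
                         (trans (cong (join m n) (h-inj {splitAt m i} {splitAt m j} eq)) (Fin.join-splitAt m n j))

enumerate : (p : Subset n) → Σ[ f ∈ (Fin ∣ p ∣ → Fin n) ]
            Injective _≡_ _≡_ f × (∀ i → f i ∈ p) × (∀ {x} → x ∈ p → ∃[ i ] f i ≡ x)
enumerate [] = (λ ()) , (λ { {()} }) , (λ ()) , λ ()
enumerate (outside ∷ p) with f , inj , f∈ , cov ← enumerate p =
  suc ∘ f , inj ∘ Fin.suc-injective , there ∘ f∈ , λ where
    (there x∈p) → let i , eq = cov x∈p in i , cong suc eq
enumerate (inside ∷ p) with f , inj , f∈ , cov ← enumerate p = g , g-inj , g∈ , g-cov
  where
  g : Fin (suc _) → Fin (suc _)
  g zero    = zero
  g (suc i) = suc (f i)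
  g-inj : Injective _≡_ _≡_ g
  g-inj {zero}  {zero}  _  = refl
  g-inj {zero}  {suc _} ()
  g-inj {suc _} {zero}  ()
  g-inj {suc _} {suc _} eq = cong suc (inj (Fin.suc-injective eq))
  g∈ : ∀ i → g i ∈ inside ∷ p
  g∈ zero    = here
  g∈ (suc i) = there (f∈ i)
  g-cov : ∀ {x} → x ∈ inside ∷ p → ∃[ i ] g i ≡ x
  g-cov here        = zero , refl
  g-cov (there x∈p) = let i , eq = cov x∈p in suc i , cong suc eq

∣p∣≤ : (p : Subset m) → AtMost (_∈ p) n → ∣ p ∣ ≤ n
∣p∣≤ p = atLeast≤atMost (let f , inj , f∈ , _ = enumerate p in listing f inj f∈)

≤∣p∣ : (p : Subset m) → AtLeast (_∈ p) n → n ≤ ∣ p ∣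
≤∣p∣ p atLeast = atLeast≤atMost atLeast (let f , _ , _ , cov = enumerate p in covering f cov)

∈⟦⟧⁺ : {P : Pred (Fin n) 0ℓ} (P? : Unary.Decidable P) {x : Fin n} → P x → x ∈ ⟦ P? ⟧
∈⟦⟧⁺ P? {x} px = lookup⇒[]= x _ (trans (lookup∘tabulate (does ∘ P?) x) (dec-true (P? x) px))

module _ (G : Graph) where
  open Graph G

  ∈N[]⁻ : ∀ {S w} → w ∈ N[_] G S → w ∈ S ⊎ (∃[ v ] v ∈ S × v ~ w)
  ∈N[]⁻ {S} = ∈⟦⟧⁻ (λ w → (w ∈? S) ⊎-dec Fin.any? (λ v → (v ∈? S) ×-dec (v ~? w)))

  ∈N[]⁺ : ∀ {S w} → w ∈ S ⊎ (∃[ v ] v ∈ S × v ~ w) → w ∈ N[_] G S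
  ∈N[]⁺ {S} = ∈⟦⟧⁺ (λ w → (w ∈? S) ⊎-dec Fin.any? (λ v → (v ∈? S) ×-dec (v ~? w)))

  ∈before⁻ : ∀ {k} {v : Fin k → Vertex} {i w} → w ∈ before G v i → ∃[ j ] j Fin.< i × v j ≡ w
  ∈before⁻ {v = v} {i} =
    ∈⟦⟧⁻ (λ w → Fin.any? (λ j → (j Fin.<? i) ×-dec (v j Fin.≟ w)))

  ∈before⁺ : ∀ {k} {v : Fin k → Vertex} {i w} → ∃[ j ] j Fin.< i × v j ≡ w → w ∈ before G v i
  ∈before⁺ {v = v} {i} =
    ∈⟦⟧⁺ (λ w → Fin.any? (λ j → (j Fin.<? i) ×-dec (v j Fin.≟ w)))

  -- If greedily chosen vertices always remove exactly the lowest remaining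
  -- level, then the i-th chosen vertex has level i.
  module _ (level : Vertex → ℕ) {M : ℕ} (level<M : ∀ v → level v < M)
    (peel : ∀ t {U v} → (∀ z → z ∈ U ⇔ t ≤ level z) → IsMinDegreeVertexIn G U v →
            ∀ {z} → t ≤ level z → (v ≡ z ⊎ v ~ z) ⇔ level z ≡ t) where

    greedySet-size≤ : ∀ {I} → IsGreedySet G I → ∣ I ∣ ≤ M
    greedySet-size≤ {I} g = ℕ.≤-trans (∣p∣≤ I I-atMost) (injective⇒≤ levelFin-injective)
      where
      open IsGreedySet g renaming (v to pick; greedy to isMin)
      open Equivalence

      Remaining : Fin size → Set
      Remaining i = ∀ z → z ∈ ∁ (N[_] G (before G pick i)) ⇔ toℕ i ≤ level z

      removes : ∀ {i} → Remaining i → ∀ {z} → toℕ i ≤ level z →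
                (pick i ≡ z ⊎ pick i ~ z) ⇔ level z ≡ toℕ i
      removes {i} rem = peel (toℕ i) rem (isMin i)

      nearby : ∀ {i z} → z ∈ before G pick i ⊎ (∃[ v ] v ∈ before G pick i × v ~ z) →
               ∃[ j ] j Fin.< i × (pick j ≡ z ⊎ pick j ~ z)
      nearby (inj₁ z∈) = let j , j<i , eq = ∈before⁻ z∈ in j , j<i , inj₁ eq
      nearby (inj₂ (v , v∈ , adj)) with j , j<i , refl ← ∈before⁻ {v = pick} v∈ = j , j<i , inj₂ adj

      remaining : ∀ n i → toℕ i ≡ n → Remaining i
      remaining = <-rec _ λ where
        _ rec i refl z → mk⇔
          (λ z∈U → ℕ.≮⇒≥ λ z<i →
            let j   = fromℕ< (ℕ.<-trans z<i (toℕ<n i))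
                j≡z = toℕ-fromℕ< (ℕ.<-trans z<i (toℕ<n i))
                j<i = subst (_< toℕ i) (sym j≡z) z<i
                j∈  = ∈before⁺ (j , j<i , refl)
            in x∈∁p⇒x∉p z∈U (∈N[]⁺
                 (Sum.map (λ eq → subst (_∈ before G pick i) eq j∈) (λ adj → pick j , j∈ , adj)
                    (from (removes (rec j<i j refl) (ℕ.≤-reflexive j≡z)) (sym j≡z)))))
          (λ i≤z → x∉p⇒x∈∁p λ z∈N →
            let j , j<i , adj = nearby (∈N[]⁻ z∈N)
            in ℕ.<-irrefl refl (ℕ.<-≤-trans (subst (_< toℕ i)
                 (sym (to (removes (rec j<i j refl) (ℕ.<⇒≤ (ℕ.<-≤-trans j<i i≤z))) adj)) j<i) i≤z))

      level-pick : ∀ i → level (pick i) ≡ toℕ i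
      level-pick i = to (removes rem (to (rem (pick i)) (proj₁ (isMin i)))) (inj₁ refl)
        where rem = remaining _ i refl

      levelFin-injective : Injective _≡_ _≡_ (λ i → fromℕ< (level<M (pick i)))
      levelFin-injective {i} {j} eq = toℕ-injective (trans (sym (level-pick i))
        (trans (Fin.fromℕ<-injective _ _ _ _ eq) (level-pick j)))

      I-atMost : AtMost (_∈ I) size
      I-atMost = covering pick λ {x} → to (enumerates x)

remQuot-injective : ∀ {m} n → Injective _≡_ _≡_ (remQuot {m} n)
remQuot-injective {m} n {i} {j} eq =
  trans (sym (combine-remQuot {m} n i)) (trans (cong (uncurry combine) eq) (combine-remQuot {m} n j))

combine-injective′ : ∀ {m n} → Injective _≡_ _≡_ (uncurry (combine {m} {n}))
combine-injective′ {x = i , j} {k , l} eq =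
  let i≡k , j≡l = Fin.combine-injective i j k l eq in cong₂ _,_ i≡k j≡l

module BlockChain (L s′ : ℕ) (size : ℕ → ℕ)
  (size-last : size L ≡ 0) (size>0 : ∀ {t} → t < L → 0 < size t) (size≤s′ : ∀ t → size t ≤ s′)
  where

  M s : ℕ
  M = suc L
  s = suc s′

  Cell : Set
  Cell = Fin M × Fin s

  block : Cell → ℕ
  block = toℕ ∘ proj₁

  InA InB : Pred Cell 0ℓ
  InA (τ , i) = toℕ i < size (toℕ τ)
  InB (τ , i) = size (toℕ τ) ≤ toℕ i

  inA? : ∀ u → Dec (InA u)
  inA? (τ , i) = toℕ i ℕ.<? size (toℕ τ)

  inB? : ∀ u → Dec (InB u)
  inB? (τ , i) = size (toℕ τ) ℕ.≤? toℕ i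

  A∩B : ∀ {u} → InA u → ¬ InB u
  A∩B = ℕ.<⇒≱

  Home Next : Rel Cell 0ℓ
  Home u v = proj₁ u ≡ proj₁ v × proj₂ u ≢ proj₂ v × (InB u ⊎ InB v)
  Next u v = InA u × InB v × block v ≡ suc (block u)

  module WithExtra (Extra : Rel Cell 0ℓ) (extra? : Decidable Extra)
    (extra-A : ∀ {u v} → Extra u v → InA u) (extra-B : ∀ {u v} → Extra u v → InB v)
    (extra-< : ∀ {u v} → Extra u v → block u < block v) where

    Forward Adj : Rel Cell 0ℓ
    Forward u v = Next u v ⊎ Extra u v
    Adj u v = Home u v ⊎ Forward u v ⊎ Forward v u

    forward-A : ∀ {u v} → Forward u v → InA u
    forward-A = [ proj₁ , extra-A ]

    forward-B : ∀ {u v} → Forward u v → InB v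
    forward-B = [ proj₁ ∘ proj₂ , extra-B ]

    forward-< : ∀ {u v} → Forward u v → block u < block v
    forward-< = [ (λ (_ , _ , eq) → ℕ.≤-reflexive (sym eq)) , extra-< ]

    home? : Decidable Home
    home? u v = (proj₁ u Fin.≟ proj₁ v) ×-dec (¬? (proj₂ u Fin.≟ proj₂ v)) ×-dec (inB? u ⊎-dec inB? v)

    forward? : Decidable Forward
    forward? u v = (inA? u ×-dec inB? v ×-dec (block v ℕ.≟ suc (block u))) ⊎-dec extra? u v

    adj? : Decidable Adj
    adj? u v = home? u v ⊎-dec forward? u v ⊎-dec forward? v u

    adj-sym : ∀ {u v} → Adj u v → Adj v u
    adj-sym (inj₁ (eq , neq , b)) = inj₁ (sym eq , neq ∘ sym , Sum.swap b)
    adj-sym (inj₂ f)              = inj₂ (Sum.swap f)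

    adj-irrefl : ∀ {u} → ¬ Adj u u
    adj-irrefl (inj₁ (_ , neq , _)) = neq refl
    adj-irrefl (inj₂ (inj₁ f))      = A∩B (forward-A f) (forward-B f)
    adj-irrefl (inj₂ (inj₂ f))      = A∩B (forward-A f) (forward-B f)

    A-independent : ∀ {u v} → InA u → InA v → ¬ Adj u v
    A-independent ua va (inj₁ (_ , _ , b))  = [ A∩B ua , A∩B va ] b
    A-independent ua va (inj₂ (inj₁ f)) = A∩B va (forward-B f)
    A-independent ua va (inj₂ (inj₂ f)) = A∩B ua (forward-B f)

    cell : Fin (M * s) → Cell
    cell = remQuot s

    graph : Graph
    graph = record
      { order    = M * s
      ; _~_      = λ u v → Adj (cell u) (cell v)
      ; _~?_     = λ u v → adj? (cell u) (cell v)
      ; ~-sym    = adj-sym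
      ; ~-irrefl = λ { refl → adj-irrefl }
      }

    open Graph graph using (_~?_)

    degree≤ : ∀ {n} v → AtMost (Adj (cell v)) n → degree graph v ≤ n
    degree≤ v = ∣p∣≤ _ ∘ atMost-image (uncurry combine) (λ {x} x∈ →
      cell x , ∈⟦⟧⁻ (v ~?_) x∈ , combine-remQuot {M} s x)

    ≤α : ∀ {n} → AtLeast InA n → n ≤ α graph
    ≤α atLeast = ℕ.≤-trans
      (≤∣p∣ _ (atLeast-image combine-injective′ (λ {x} x∈ →
        ∈⟦⟧⁺ inA-cell? (subst InA (sym (remQuot-combine (proj₁ x) (proj₂ x))) x∈)) atLeast))
      (proj₂ (α-isIndependenceNumber graph) ⟦ inA-cell? ⟧ λ u v u∈ v∈ →
        A-independent (∈⟦⟧⁻ inA-cell? u∈) (∈⟦⟧⁻ inA-cell? v∈))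
      where
      inA-cell? = λ v → inA? (cell v)

    module _ {U t} (U⇔ : ∀ z → z ∈ U ⇔ t ≤ block (cell z)) where
      open Equivalence

      degreeIn≤ : ∀ {n} v → AtMost (λ z → Adj (cell v) z × t ≤ block z) n → degreeIn graph U v ≤ n
      degreeIn≤ v = ∣p∣≤ _ ∘ atMost-image (uncurry combine) (λ {x} x∈ →
        let x∈U , x∈N = x∈p∩q⁻ U _ x∈ in
        cell x , (∈⟦⟧⁻ (v ~?_) x∈N , to (U⇔ x) x∈U) , combine-remQuot {M} s x)

      ≤degreeIn : ∀ {n} v → AtLeast (λ z → Adj (cell v) z × t ≤ block z) n → n ≤ degreeIn graph U v
      ≤degreeIn v = ≤∣p∣ _ ∘ atLeast-image combine-injective′ (λ {x} (adj , t≤) →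
        let eq = sym (remQuot-combine (proj₁ x) (proj₂ x)) in
        x∈p∩q⁺ ( from (U⇔ _) (subst (λ z → t ≤ block z) eq t≤)
               , ∈⟦⟧⁺ (v ~?_) (subst (Adj (cell v)) eq adj)))

    atMost-sameBlock : ∀ τ i → AtMost (λ (v : Cell) → τ ≡ proj₁ v × i ≢ proj₂ v) s′
    atMost-sameBlock τ i = covering (λ j → τ , punchIn i j) λ where
      (refl , neq) → punchOut neq , cong (τ ,_) (punchIn-punchOut neq)

    atLeast-sameBlock : ∀ τ i → AtLeast (λ (v : Cell) → τ ≡ proj₁ v × i ≢ proj₂ v) s′
    atLeast-sameBlock τ i = listing (λ j → τ , punchIn i j)
      (λ eq → punchIn-injective i _ _ (cong proj₂ eq))
      λ j → refl , punchInᵢ≢i i j ∘ sym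

    A-block<L : ∀ {u} → InA u → block u < L
    A-block<L {u@(τ , i)} ua = ℕ.≤∧≢⇒< (ℕ.≤-pred (toℕ<n τ)) λ eq →
      ℕ.n≮0 (subst (toℕ i <_) (trans (cong size eq) size-last) ua)

    B-degree-top : ∀ {v} → InB v → AtMost (λ z → Adj v z × block v ≤ block z) s′
    B-degree-top {τ , i} vb = atMost-⊆ (λ where
      (inj₁ (eq , neq , _) , _)  → eq , neq
      (inj₂ (inj₁ f) , _) → contradiction vb (A∩B (forward-A f))
      (inj₂ (inj₂ f) , t≤) → contradiction t≤ (ℕ.<⇒≱ (forward-< f))) (atMost-sameBlock τ i)

    B-degree-below : ∀ {v t} → InB v → t < block v → AtLeast (λ z → Adj v z × t ≤ block z) s
    B-degree-below {v@(suc τ , i)} {t} vb t<v =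
      atLeast-⊆ (λ where
        (inj₁ refl) → inj₂ (inj₂ (inj₁ (prev-A , vb , cong suc (sym prev≡)))) , subst (t ≤_) (sym prev≡) (ℕ.≤-pred t<v)
        (inj₂ (refl , neq)) → inj₁ (refl , neq , inj₁ vb) , ℕ.<⇒≤ t<v)
      (atLeast-∪ (λ { refl (eq , _) → ℕ.1+n≢n (trans (cong toℕ eq) prev≡) })
        single (atLeast-sameBlock (suc τ) i))
      where
      prev : Cell
      prev = Fin.inject₁ τ , zero
      prev≡ : block prev ≡ toℕ τ
      prev≡ = Fin.toℕ-inject₁ τ
      prev-A : InA prev
      prev-A = subst (λ t → 0 < size t) (sym prev≡) (size>0 (toℕ<n τ))
      single : AtLeast (prev ≡_) 1
      single = listing (λ _ → prev) (λ { {zero} {zero} _ → refl }) λ _ → refl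

    adj-A-block : ∀ {u z} → InA u → Adj u z → block u ≤ block z
    adj-A-block ua (inj₁ (eq , _)) = ℕ.≤-reflexive (cong toℕ eq)
    adj-A-block ua (inj₂ (inj₁ f)) = ℕ.<⇒≤ (forward-< f)
    adj-A-block ua (inj₂ (inj₂ f)) = contradiction (forward-B f) (A∩B ua)

    module _ (A-degree : ∀ {u} → InA u → AtLeast (Adj u) s) where

      minDegreeVertex : ∀ t {U v} → (∀ z → z ∈ U ⇔ t ≤ block (cell z)) →
                        IsMinDegreeVertexIn graph U v → InB (cell v) × block (cell v) ≡ t
      minDegreeVertex t {U} {v} U⇔ (v∈U , v-min) = v-B , block≡t
        where
        open Equivalence

        t≤v : t ≤ block (cell v)
        t≤v = to (U⇔ v) v∈U

        t<M : t < M
        t<M = ℕ.≤-<-trans t≤v (toℕ<n (proj₁ (cell v)))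

        top : Cell
        top = fromℕ< t<M , Fin.fromℕ s′

        cell-top : cell (uncurry combine top) ≡ top
        cell-top = remQuot-combine (proj₁ top) (proj₂ top)

        block-top : block top ≡ t
        block-top = toℕ-fromℕ< t<M

        top-B : InB top
        top-B = subst (size (block top) ≤_) (sym (Fin.toℕ-fromℕ s′)) (size≤s′ (block top))

        degree<s : degreeIn graph U v < s
        degree<s = s≤s (ℕ.≤-trans
          (v-min {uncurry combine top} (from (U⇔ _) (ℕ.≤-reflexive (sym (trans (cong block cell-top) block-top)))))
          (degreeIn≤ U⇔ (uncurry combine top) (subst₂
            (λ u t → AtMost (λ z → Adj u z × t ≤ block z) s′) (sym cell-top) block-top
            (B-degree-top top-B))))

        v-B : InB (cell v)
        v-B = ℕ.≮⇒≥ λ v-A → ℕ.<⇒≱ degree<s (≤degreeIn U⇔ v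
          (atLeast-⊆ (λ adj → adj , ℕ.≤-trans t≤v (adj-A-block v-A adj)) (A-degree v-A)))

        block≡t : block (cell v) ≡ t
        block≡t = ℕ.≤-antisym (ℕ.≮⇒≥ λ t<v →
          ℕ.<⇒≱ degree<s (≤degreeIn U⇔ v (B-degree-below v-B t<v))) t≤v

      greedySet≤M : ∀ {I} → IsGreedySet graph I → ∣ I ∣ ≤ M
      greedySet≤M = greedySet-size≤ graph (block ∘ cell) (toℕ<n ∘ proj₁ ∘ cell)
        λ t {v = v} U⇔ v-min {z} t≤z →
          let v-B , v≡t = minDegreeVertex t U⇔ v-min in mk⇔ (removed⇒ v-B v≡t t≤z) (removed⇐ v-B v≡t)
        where
        removed⇒ : ∀ {v z t} → InB (cell v) → block (cell v) ≡ t → t ≤ block (cell z) →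
                   v ≡ z ⊎ Adj (cell v) (cell z) → block (cell z) ≡ t
        removed⇒ _   v≡t _   (inj₁ refl)              = v≡t
        removed⇒ _   v≡t _   (inj₂ (inj₁ (same , _))) = trans (cong toℕ (sym same)) v≡t
        removed⇒ v-B _   _   (inj₂ (inj₂ (inj₁ f)))   = contradiction v-B (A∩B (forward-A f))
        removed⇒ _   refl t≤z (inj₂ (inj₂ (inj₂ f)))  = contradiction t≤z (ℕ.<⇒≱ (forward-< f))

        removed⇐ : ∀ {v z t} → InB (cell v) → block (cell v) ≡ t → block (cell z) ≡ t →
                   v ≡ z ⊎ Adj (cell v) (cell z)
        removed⇐ {v} {z} v-B v≡t z≡t with v Fin.≟ z
        ... | yes v≡z = inj₁ v≡z
        ... | no  v≢z = inj₂ (inj₁ (same , (λ eq → v≢z (remQuot-injective {M} s (cong₂ _,_ same eq))) , inj₁ v-B))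
          where same = toℕ-injective (trans v≡t (sym z≡t))

cast-injective : ∀ {m n} .(eq : m ≡ n) → Injective _≡_ _≡_ (Fin.cast eq)
cast-injective eq {i} {j} ceq =
  toℕ-injective (trans (sym (Fin.toℕ-cast eq i)) (trans (cong toℕ ceq) (Fin.toℕ-cast eq j)))

module _ {m s : ℕ} where

  atLeast-row : ∀ {t p q} → t < m → p + q ≡ s →
                AtLeast (λ (z : Fin m × Fin s) → toℕ (proj₁ z) ≡ t × p ≤ toℕ (proj₂ z)) q
  atLeast-row {p = p} t<m refl = listing (λ i → fromℕ< t<m , p ↑ʳ i)
    (λ eq → Fin.↑ʳ-injective p _ _ (cong proj₂ eq))
    λ i → toℕ-fromℕ< t<m , subst (p ≤_) (sym (Fin.toℕ-↑ʳ p i)) (ℕ.m≤m+n p (toℕ i))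

  atMost-row : ∀ {t p q} → t < m → p + q ≡ s →
               AtMost (λ (z : Fin m × Fin s) → toℕ (proj₁ z) ≡ t × p ≤ toℕ (proj₂ z)) q
  atMost-row {p = p} {q} t<m refl = covering (λ i → fromℕ< t<m , p ↑ʳ i) λ {z} (eq , p≤) →
    let i = proj₂ z
        i∸p<q = ℕ.+-cancelˡ-< p _ _ (subst (_< p + q) (sym (ℕ.m+[n∸m]≡n p≤)) (toℕ<n i))
    in fromℕ< i∸p<q , cong₂ _,_
      (toℕ-injective (trans (toℕ-fromℕ< t<m) (sym eq)))
      (toℕ-injective (trans (Fin.toℕ-↑ʳ p _) (trans (cong (_+_ p) (toℕ-fromℕ< i∸p<q)) (ℕ.m+[n∸m]≡n p≤))))

  atMost-previousRow : ∀ (v : Fin m × Fin s) {p} → p ≤ s →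
    AtMost (λ (z : Fin m × Fin s) → toℕ (proj₁ v) ≡ suc (toℕ (proj₁ z)) × toℕ (proj₂ z) < p) p
  atMost-previousRow v@(zero  , _) p≤s = covering (λ _ → v) λ { (() , _) }
  atMost-previousRow (suc τ , _) p≤s = covering (λ i → inject₁ τ , inject≤ i p≤s) λ {z} (eq , i<p) →
    fromℕ< i<p , cong₂ _,_
      (toℕ-injective (trans (Fin.toℕ-inject₁ τ) (ℕ.suc-injective eq)))
      (toℕ-injective (trans (Fin.toℕ-inject≤ _ p≤s) (toℕ-fromℕ< i<p)))

module Construction (k′ r G H : ℕ) (0<r : 0 < r) (r≤k′ : r ≤ k′) (balance : G * (suc k′ + r) ≡ H * suc k′) where

  -- E early blocks, one buffer block, F late blocks, and the final clique at index L.
  -- The buffer already receives k + r edges per B-vertex from the last early block.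
  k E F L Λ : ℕ
  k = suc k′
  E = r * G
  F = (r + r) * H
  L = E + suc F
  Λ = G * (k + r)

  E<L : E < L
  E<L = ℕ.m<m+n E (s≤s z≤n)

  -- Abstract, so that case distinctions on the block do not unfold it.
  abstract
    size : ℕ → ℕ
    size t with t ℕ.<? E | t ℕ.<? L
    ... | yes _ | _     = k + r
    ... | no _  | yes _ = k
    ... | no _  | no _  = 0

    size-< : ∀ {t} → t < E → size t ≡ k + r
    size-< {t} t<E with t ℕ.<? E | t ℕ.<? L
    ... | yes _  | _ = refl
    ... | no t≮E | _ = contradiction t<E t≮E

    size-≥ : ∀ {t} → E ≤ t → t < L → size t ≡ k
    size-≥ {t} E≤t t<L with t ℕ.<? E | t ℕ.<? L
    ... | yes t<E | _      = contradiction E≤t (ℕ.<⇒≱ t<E)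
    ... | no _    | yes _  = refl
    ... | no _    | no t≮L = contradiction t<L t≮L

    size-last : size L ≡ 0
    size-last with L ℕ.<? E | L ℕ.<? L
    ... | yes L<E | _       = contradiction E<L (ℕ.<⇒≯ L<E)
    ... | no _    | yes L<L = contradiction L<L (ℕ.<-irrefl refl)
    ... | no _    | no _    = refl

    k≤size : ∀ {t} → t < L → k ≤ size t
    k≤size {t} t<L with t ℕ.<? E | t ℕ.<? L
    ... | yes _ | _      = ℕ.m≤m+n k r
    ... | no _  | yes _  = ℕ.≤-refl
    ... | no _  | no t≮L = contradiction t<L t≮L

    size≤k+r : ∀ t → size t ≤ k + r
    size≤k+r t with t ℕ.<? E | t ℕ.<? L
    ... | yes _ | _     = ℕ.≤-refl
    ... | no _  | yes _ = ℕ.m≤m+n k r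
    ... | no _  | no _  = z≤n

    size≤k : ∀ {t} → E ≤ t → size t ≤ k
    size≤k {t} E≤t with t ℕ.<? E | t ℕ.<? L
    ... | yes t<E | _     = contradiction E≤t (ℕ.<⇒≱ t<E)
    ... | no _    | yes _ = ℕ.≤-refl
    ... | no _    | no _  = z≤n

  k+r≤s′ : k + r ≤ k′ + k
  k+r≤s′ = ℕ.≤-trans (ℕ.+-monoʳ-≤ k r≤k′) (ℕ.≤-reflexive (ℕ.+-comm k k′))

  open BlockChain L (k′ + k) size size-last
    (λ t<L → ℕ.≤-trans (s≤s z≤n) (k≤size t<L))
    (λ t → ℕ.≤-trans (size≤k+r t) k+r≤s′)

  k+r≤s : k + r ≤ s
  k+r≤s = ℕ.m≤n⇒m≤1+n k+r≤s′

  early : Fin r → Fin Λ → Cell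
  early a l = let g , i = remQuot (k + r) l in
    inject₁ (combine a g ↑ˡ suc F) , inject≤ i k+r≤s

  late : (Fin k → Fin s) → Fin (r + r) → Fin Λ → Cell
  late e w l = let h , i = remQuot k (Fin.cast balance l) in
    inject₁ (E ↑ʳ suc (combine w h)) , e i

  lateA lateB : Fin (r + r) → Fin Λ → Cell
  lateA = late (_↑ˡ k)
  lateB = late (k ↑ʳ_)

  early-injective : ∀ {a l a′ l′} → early a l ≡ early a′ l′ → a ≡ a′ × l ≡ l′
  early-injective {a} {l} {a′} {l′} eq =
    let a≡ , g≡ = Fin.combine-injective a _ a′ _
                    (Fin.↑ˡ-injective (suc F) _ _ (Fin.inject₁-injective (cong proj₁ eq)))
        i≡ = Fin.inject≤-injective k+r≤s k+r≤s _ _ (cong proj₂ eq)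
    in a≡ , remQuot-injective {G} (k + r) (cong₂ _,_ g≡ i≡)

  late-injective : ∀ {e} → Injective _≡_ _≡_ e → ∀ {w l w′ l′} → late e w l ≡ late e w′ l′ → w ≡ w′ × l ≡ l′
  late-injective e-inj {w} {l} {w′} {l′} eq =
    let w≡ , h≡ = Fin.combine-injective w _ w′ _
                    (Fin.suc-injective (Fin.↑ʳ-injective E _ _ (Fin.inject₁-injective (cong proj₁ eq))))
        i≡ = e-inj (cong proj₂ eq)
    in w≡ , cast-injective balance (remQuot-injective {H} k (cong₂ _,_ h≡ i≡))

  early-block : ∀ a l → block (early a l) < E
  early-block a l = subst (_< E) (sym (trans (Fin.toℕ-inject₁ _) (Fin.toℕ-↑ˡ _ (suc F)))) (toℕ<n _)

  late-block : ∀ e w l → E < block (late e w l) × block (late e w l) < L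
  late-block e w l = subst (λ t → E < t × t < L)
    (sym (trans (Fin.toℕ-inject₁ _) (Fin.toℕ-↑ʳ E (suc (combine w _)))))
    (ℕ.m<m+n E (s≤s z≤n) , ℕ.+-monoʳ-< E (s≤s (toℕ<n (combine w _))))

  late-size : ∀ e w l → size (block (late e w l)) ≡ k
  late-size e w l = let E< , <L = late-block e w l in size-≥ (ℕ.<⇒≤ E<) <L

  early-A : ∀ a l → InA (early a l)
  early-A a l = subst₂ _<_ (sym (Fin.toℕ-inject≤ _ k+r≤s)) (sym (size-< (early-block a l)))
    (toℕ<n (proj₂ (remQuot {G} (k + r) l)))

  lateA-A : ∀ w l → InA (lateA w l)
  lateA-A w l = subst₂ _<_ (sym (Fin.toℕ-↑ˡ _ k)) (sym (late-size (_↑ˡ k) w l))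
    (toℕ<n (proj₂ (remQuot {H} k (Fin.cast balance l))))

  lateB-B : ∀ w l → InB (lateB w l)
  lateB-B w l = subst₂ _≤_ (sym (late-size (k ↑ʳ_) w l)) (sym (Fin.toℕ-↑ʳ k _)) (ℕ.m≤m+n k _)

  early-surjective : ∀ {u} → InA u → block u < E → ∃[ a ] ∃[ l ] u ≡ early a l
  early-surjective {τ , i} u-A τ<E =
    let c       = fromℕ< τ<E
        a , g   = remQuot {r} G c
        i<k+r   = subst (toℕ i <_) (size-< τ<E) u-A
        i′      = fromℕ< i<k+r
        l       = combine g i′
        τ≡ = trans (Fin.toℕ-inject₁ _) (trans (Fin.toℕ-↑ˡ _ (suc F))
               (trans (cong (λ x → toℕ (combine a (proj₁ x))) (remQuot-combine g i′))
               (trans (cong toℕ (combine-remQuot {r} G c)) (toℕ-fromℕ< τ<E))))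
        i≡ = trans (Fin.toℕ-inject≤ _ k+r≤s)
               (trans (cong (λ x → toℕ (proj₂ x)) (remQuot-combine g i′)) (toℕ-fromℕ< i<k+r))
    in a , l , cong₂ _,_ (toℕ-injective (sym τ≡)) (toℕ-injective (sym i≡))

  -- Each label l < Λ joins r early A-vertices to 2r late B-vertices.
  Extra : Rel Cell 0ℓ
  Extra u v = ∃[ l ] (∃[ a ] u ≡ early a l) × (∃[ w ] v ≡ lateB w l)

  infix 4 _≟_
  _≟_ : Decidable {A = Cell} _≡_
  _≟_ = ≡-dec Fin._≟_ Fin._≟_

  extra? : Decidable Extra
  extra? u v = Fin.any? λ l → Fin.any? (λ a → u ≟ early a l) ×-dec Fin.any? (λ w → v ≟ lateB w l)

  extra-source<E : ∀ {u v} → Extra u v → block u < E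
  extra-source<E (l , (a , refl) , _) = early-block a l

  extra-target>E : ∀ {u v} → Extra u v → E < block v
  extra-target>E (l , _ , w , refl) = proj₁ (late-block (k ↑ʳ_) w l)

  extra-A : ∀ {u v} → Extra u v → InA u
  extra-A (l , (a , refl) , _) = early-A a l

  extra-B : ∀ {u v} → Extra u v → InB v
  extra-B (l , _ , w , refl) = lateB-B w l

  open WithExtra Extra extra? extra-A extra-B
    (λ e → ℕ.<-trans (extra-source<E e) (extra-target>E e))

  atLeast-extra : ∀ {u} → InA u → block u < E → AtLeast (Extra u) (r + r)
  atLeast-extra u-A u<E with a , l , refl ← early-surjective u-A u<E =
    listing (λ w → lateB w l) (λ eq → proj₁ (late-injective (Fin.↑ʳ-injective k _ _) eq))
      λ w → l , (a , refl) , w , refl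

  atMost-extra : ∀ u → InA u → block u < E → AtMost (Extra u) (r + r)
  atMost-extra u u-A u<E with a , l , refl ← early-surjective u-A u<E =
    covering (λ w → lateB w l) λ where
      (l′ , (a′ , eq) , w , refl) → w , cong (lateB w) (proj₂ (early-injective {a} {l} {a′} {l′} eq))

  atMost-extraInto : ∀ v → AtMost (λ u → Extra u v) r
  atMost-extraInto v with Fin.any? (λ l → Fin.any? (λ w → v ≟ lateB w l))
  ... | yes (l , w , refl) = covering (λ a → early a l) λ where
          (l′ , (a , refl) , w′ , eq) →
            a , cong (early a) (proj₂ (late-injective (Fin.↑ʳ-injective k _ _) {w} {l} {w′} {l′} eq))
  ... | no ∄ = covering (λ _ → v) λ (l , _ , w , eq) → contradiction (l , w , eq) ∄

  home-A-B : ∀ {u z} → InA u → InB z → block z ≡ block u → Adj u z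
  home-A-B {τ , i} {τ′ , j} u-A z-B eq with refl ← toℕ-injective eq =
    inj₁ (refl , (λ { refl → A∩B u-A z-B }) , inj₂ z-B)

  next-A-B : ∀ {u z} → InA u → InB z → block z ≡ suc (block u) → Adj u z
  next-A-B u-A z-B eq = inj₂ (inj₁ (inj₁ (u-A , z-B , eq)))

  k+k≡s : k + k ≡ s
  k+k≡s = refl

  k+r+[k∸r]≡s : k + r + (k ∸ r) ≡ s
  k+r+[k∸r]≡s = trans (ℕ.+-assoc k r (k ∸ r)) (cong (_+_ k) (ℕ.m+[n∸m]≡n (ℕ.m≤n⇒m≤1+n r≤k′)))

  A-degree : ∀ {u} → InA u → AtLeast (Adj u) s
  A-degree {u} u-A with block u ℕ.<? E
  ... | yes u<E = subst (AtLeast (Adj u)) total (atLeast-⊆ (λ where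
          (inj₁ (eq , p≤)) → home-A-B u-A (ℕ.≤-trans (size≤k+r _) p≤) eq
          (inj₂ (inj₁ (eq , p≤))) → next-A-B u-A (ℕ.≤-trans (size≤k+r _) p≤) eq
          (inj₂ (inj₂ e)) → inj₂ (inj₁ (inj₂ e)))
        (atLeast-∪ (λ (eq , _) → λ where
            (inj₁ (eq′ , _)) → ℕ.1+n≢n (trans (sym eq′) eq)
            (inj₂ e) → ℕ.<-asym u<E (subst (E <_) eq (extra-target>E e)))
          (atLeast-row (toℕ<n (proj₁ u)) k+r+[k∸r]≡s)
          (atLeast-∪ (λ (eq , _) e → ℕ.<⇒≱ (extra-target>E e) (subst (_≤ E) (sym eq) u<E))
            (atLeast-row (s≤s (A-block<L u-A)) k+r+[k∸r]≡s) (atLeast-extra u-A u<E))))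
    where
    total : (k ∸ r) + ((k ∸ r) + (r + r)) ≡ s
    total = trans (solve 2 (λ x y → x :+ (x :+ (y :+ y)) := (y :+ x) :+ (y :+ x)) refl (k ∸ r) r)
                  (cong₂ _+_ r+[k∸r]≡k r+[k∸r]≡k)
      where
      open +-*-Solver
      r+[k∸r]≡k = ℕ.m+[n∸m]≡n (ℕ.m≤n⇒m≤1+n r≤k′)
  ... | no u≮E = atLeast-⊆ (λ where
          (inj₁ (eq , k≤)) → home-A-B u-A (ℕ.≤-trans (size≤k (subst (E ≤_) (sym eq) E≤u)) k≤) eq
          (inj₂ (eq , k≤)) → next-A-B u-A (ℕ.≤-trans (size≤k (subst (E ≤_) (sym eq) (ℕ.m≤n⇒m≤1+n E≤u))) k≤) eq)
        (atLeast-∪ (λ (eq , _) (eq′ , _) → ℕ.1+n≢n (trans (sym eq′) eq))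
          (atLeast-row (toℕ<n (proj₁ u)) k+k≡s)
          (atLeast-row (s≤s (A-block<L u-A)) k+k≡s))
    where
    E≤u = ℕ.≮⇒≥ u≮E

  A-degree≤ : ∀ {u} → InA u → ∃[ d ] d ≤ k′ + k + (k + r) × AtMost (Adj u) d
  A-degree≤ {u} u-A with block u ℕ.<? E
  ... | yes u<E = k + (k + (r + r)) , bound , atMost-⊆ (λ where
          (inj₁ (refl , _ , inj₁ u-B)) → contradiction u-B (A∩B u-A)
          {z} (inj₁ (refl , _ , inj₂ z-B)) → inj₁ (refl , ℕ.≤-trans (k≤size u<L) z-B)
          {z} (inj₂ (inj₁ (inj₁ (_ , z-B , eq)))) → inj₂ (inj₁ (eq ,
             ℕ.≤-trans (k≤size (subst (_< L) (sym eq) (ℕ.≤-<-trans u<E E<L))) z-B))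
          (inj₂ (inj₁ (inj₂ e))) → inj₂ (inj₂ e)
          (inj₂ (inj₂ f)) → contradiction (forward-B f) (A∩B u-A))
        (atMost-∪ (atMost-row (toℕ<n (proj₁ u)) k+k≡s)
          (atMost-∪ (atMost-row (s≤s u<L) k+k≡s) (atMost-extra u u-A u<E)))
    where
    u<L = A-block<L u-A
    bound : k + (k + (r + r)) ≤ k′ + k + (k + r)
    bound = subst₂ _≤_
      (solve 2 (λ x y → x :+ (x :+ y) :+ y := x :+ (x :+ (y :+ y))) refl k r)
      (solve 3 (λ x y z → x :+ (x :+ y) :+ z := z :+ x :+ (x :+ y)) refl k r k′)
      (ℕ.+-monoʳ-≤ (k + (k + r)) r≤k′)
      where open +-*-Solver
  ... | no u≮E = k + s , bound , atMost-⊆ (λ where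
          (inj₁ (refl , _ , inj₁ u-B)) → contradiction u-B (A∩B u-A)
          {z} (inj₁ (refl , _ , inj₂ z-B)) → inj₁ (refl , ℕ.≤-trans (k≤size u<L) z-B)
          (inj₂ (inj₁ (inj₁ (_ , _ , eq)))) → inj₂ (eq , z≤n)
          (inj₂ (inj₁ (inj₂ e))) → contradiction (extra-source<E e) u≮E
          (inj₂ (inj₂ f)) → contradiction (forward-B f) (A∩B u-A))
        (atMost-∪ (atMost-row (toℕ<n (proj₁ u)) k+k≡s) (atMost-row (s≤s u<L) refl))
    where
    u<L = A-block<L u-A
    bound : k + s ≤ k′ + k + (k + r)
    bound = subst₂ _≤_
      (solve 2 (λ x z → z :+ x :+ x :+ con 1 := x :+ (con 1 :+ (z :+ x))) refl k k′)
      (ℕ.+-assoc (k′ + k) k r)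
      (ℕ.+-monoʳ-≤ (k′ + k + k) 0<r)
      where open +-*-Solver

  B-degree≤ : ∀ {v} → InB v → AtMost (Adj v) (k′ + k + (k + r))
  B-degree≤ {v@(τ , i)} v-B with toℕ τ ℕ.≤? E
  ... | yes v≤E = atMost-⊆ (λ where
          (inj₁ (eq , neq , _)) → inj₁ (eq , neq)
          (inj₂ (inj₁ f)) → contradiction v-B (A∩B (forward-A f))
          {z} (inj₂ (inj₂ (inj₁ (z-A , _ , eq)))) → inj₂ (eq , ℕ.<-≤-trans z-A (size≤k+r (block z)))
          (inj₂ (inj₂ (inj₂ e))) → contradiction v≤E (ℕ.<⇒≱ (extra-target>E e)))
        (atMost-∪ (atMost-sameBlock τ i) (atMost-previousRow v k+r≤s))
  ... | no v≰E = atMost-⊆ (λ where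
          (inj₁ (eq , neq , _)) → inj₁ (eq , neq)
          (inj₂ (inj₁ f)) → contradiction v-B (A∩B (forward-A f))
          {z} (inj₂ (inj₂ (inj₁ (z-A , _ , eq)))) →
            inj₂ (inj₁ (eq , ℕ.<-≤-trans z-A (size≤k (ℕ.≤-pred (subst (E <_) eq (ℕ.≰⇒> v≰E))))))
          (inj₂ (inj₂ (inj₂ e))) → inj₂ (inj₂ e))
        (atMost-∪ (atMost-sameBlock τ i)
          (atMost-∪ (atMost-previousRow v (ℕ.≤-trans (ℕ.m≤m+n k r) k+r≤s)) (atMost-extraInto v)))

  maxDegree : MaxDegree≤ graph (k′ + k + (k + r))
  maxDegree v with inA? (cell v)
  ... | yes v-A = let d , d≤ , atMost = A-degree≤ v-A in ℕ.≤-trans (degree≤ v atMost) d≤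
  ... | no ¬v-A = degree≤ v (B-degree≤ (ℕ.≮⇒≥ ¬v-A))

  independenceNumber≥ : r * Λ + (r + r) * Λ ≤ α graph
  independenceNumber≥ = ≤α (atLeast-⊆ (λ where
      (inj₁ (a , l , refl)) → early-A a l
      (inj₂ (w , l , refl)) → lateA-A w l)
    (atLeast-∪ (λ where
        (a , l , refl) (w , l′ , eq) → ℕ.<-asym (early-block a l)
          (subst (E <_) (sym (cong block eq)) (proj₁ (late-block (_↑ˡ k) w l′))))
      (grid early early-injective) (grid lateA (late-injective (Fin.↑ˡ-injective k _ _)))))
    where
    grid : ∀ {c} (f : Fin c → Fin Λ → Cell) → (∀ {a l a′ l′} → f a l ≡ f a′ l′ → a ≡ a′ × l ≡ l′) →
           AtLeast (λ u → ∃[ a ] ∃[ l ] u ≡ f a l) (c * Λ)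
    grid {c} f f-inj = listing (uncurry f ∘ remQuot Λ)
      (λ eq → let a≡ , l≡ = f-inj eq in remQuot-injective {c} Λ (cong₂ _,_ a≡ l≡))
      λ i → _ , _ , refl

  -- Abstract, since comparing types that mention α of the explicit graph is very slow.
  abstract
    badGraph : Graph
    badGraph = graph

    badGraph-nonempty : NonZero (Graph.order badGraph)
    badGraph-nonempty = _

    badGraph-maxDegree : MaxDegree≤ badGraph (k′ + k + (k + r))
    badGraph-maxDegree = maxDegree

    badGraph-α≥ : r * Λ + (r + r) * Λ ≤ α badGraph
    badGraph-α≥ = independenceNumber≥

    badGraph-greedySet≤ : ∀ {I} → IsGreedySet badGraph I → ∣ I ∣ ≤ M
    badGraph-greedySet≤ = greedySet≤M A-degree

c : ℚ
c = + 100 / 1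

loss-bound : ∀ Δ .{{_ : NonZero Δ}} a d .{{_ : NonZero d}} →
  suc Δ * d * Δ ≤ 3 * (a * Δ + 100 * d) → + suc Δ / 3 - c ℚ.* (+ 1 / Δ) ℚ.≤ + a / d
loss-bound Δ@(suc Δ′) a d@(suc d′) le = begin
  x - y           ≤⟨ ℚ.+-monoˡ-≤ (ℚ.- y) x≤z+y ⟩
  z ℚ.+ y - y     ≡⟨ ℚ.+-assoc z y (ℚ.- y) ⟩
  z ℚ.+ (y - y)   ≡⟨ cong (z ℚ.+_) (ℚ.+-inverseʳ y) ⟩
  z ℚ.+ 0ℚ        ≡⟨ ℚ.+-identityʳ z ⟩
  z               ∎
  where
  open ℚ.≤-Reasoning
  x y z : ℚ
  x = + suc Δ / 3
  y = c ℚ.* (+ 1 / Δ)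
  z = + a / d

  cleared : + suc Δ ℤ.* + (d * (1 * Δ)) ℤ.≤ (+ a ℤ.* + (1 * Δ) ℤ.+ (+ 100 ℤ.* + 1) ℤ.* + d) ℤ.* + 3
  cleared = subst₂ ℤ._≤_
    (trans (cong +_ (solve 2 (λ d Δ → (con 1 :+ Δ) :* d :* Δ := (con 1 :+ Δ) :* (d :* (con 1 :* Δ))) refl d Δ))
           (ℤ.pos-* (suc Δ) (d * (1 * Δ))))
    (trans (cong +_ (solve 3 (λ a d Δ → con 3 :* (a :* Δ :+ con 100 :* d) :=
                                        (a :* (con 1 :* Δ) :+ con 100 :* d) :* con 3) refl a d Δ))
    (trans (ℤ.pos-* (a * (1 * Δ) + 100 * d) 3)
           (cong (ℤ._* + 3) (trans (ℤ.pos-+ (a * (1 * Δ)) (100 * d)) (cong₂ ℤ._+_ (ℤ.pos-* a (1 * Δ)) (ℤ.pos-* 100 d))))))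
    (ℤ.+≤+ le)
    where open +-*-Solver

  toℚᵘ-/ : ∀ n d → toℚᵘ (n / suc d) ℚᵘ.≃ mkℚᵘ n d
  toℚᵘ-/ n d = ℚ.toℚᵘ-fromℚᵘ (mkℚᵘ n d)

  x≤z+y : x ℚ.≤ z ℚ.+ y
  x≤z+y = ℚ.toℚᵘ-cancel-≤
    (ℚᵘ.≤-respˡ-≃ (ℚᵘ.≃-sym (toℚᵘ-/ (+ suc Δ) 2))
    (ℚᵘ.≤-respʳ-≃ (ℚᵘ.≃-sym (ℚᵘ.≃-trans (ℚ.toℚᵘ-homo-+ z y)
      (ℚᵘ.+-cong (toℚᵘ-/ (+ a) d′) (ℚᵘ.≃-trans (ℚ.toℚᵘ-homo-* c (+ 1 / Δ)) (ℚᵘ.*-cong (ℚᵘ.≃-refl {toℚᵘ c}) (toℚᵘ-/ (+ 1) Δ′))))))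
    (*≤* cleared)))

clear-denominators : ∀ {Δ N M a d} .{{_ : NonZero M}} →
  suc Δ * M * Δ ≤ 3 * (N * Δ + 100 * M) → N ≤ a → d ≤ M →
  suc Δ * d * Δ ≤ 3 * (a * Δ + 100 * d)
clear-denominators {Δ} {N} {M} {a} {d} le N≤a d≤M = ℕ.*-cancelˡ-≤ M (begin
  M * (suc Δ * d * Δ)                ≡⟨ solve 3 (λ M d Δ → M :* ((con 1 :+ Δ) :* d :* Δ) := d :* ((con 1 :+ Δ) :* M :* Δ)) refl M d Δ ⟩
  d * (suc Δ * M * Δ)                ≤⟨ ℕ.*-monoʳ-≤ d le ⟩
  d * (3 * (N * Δ + 100 * M))        ≡⟨ solve 4 (λ M d N Δ → d :* (con 3 :* (N :* Δ :+ con 100 :* M)) := con 3 :* (d :* N :* Δ :+ con 100 :* (M :* d))) refl M d N Δ ⟩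
  3 * (d * N * Δ + 100 * (M * d))    ≤⟨ ℕ.*-monoʳ-≤ 3 (ℕ.+-monoˡ-≤ (100 * (M * d)) (ℕ.*-monoˡ-≤ Δ (ℕ.*-mono-≤ d≤M N≤a))) ⟩
  3 * (M * a * Δ + 100 * (M * d))    ≡⟨ solve 4 (λ M d a Δ → con 3 :* (M :* a :* Δ :+ con 100 :* (M :* d)) := M :* (con 3 :* (a :* Δ :+ con 100 :* d))) refl M d a Δ ⟩
  M * (3 * (a * Δ + 100 * d))        ∎)
  where
  open ℕ.≤-Reasoning
  open +-*-Solver

labels-balanced : ∀ k r → k * k * (k + r) ≡ k * (k + r) * k
labels-balanced = solve 2 (λ k r → k :* k :* (k :+ r) := k :* (k :+ r) :* k) refl
  where open +-*-Solver

-- G = k² makes the chain long enough for its two exceptional blocks to cost only O(1/k).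
module Parameters (k′ r : ℕ) where
  k Δ Λ M N : ℕ
  k = suc k′
  Δ = k′ + k + (k + r)
  Λ = k * k * (k + r)
  M = suc (r * (k * k) + suc ((r + r) * (k * (k + r))))
  N = r * Λ + (r + r) * Λ

surplus-bound : ∀ k′ (r : Fin 3) → let open Parameters k′ (suc (toℕ r)) in
                suc Δ * M * Δ ≤ 3 * (N * Δ + 100 * M)
surplus-bound k′ r = ℕ.≤-trans (ℕ.m≤m+n _ (surplus r)) (ℕ.≤-reflexive (identity r))
  where
  open +-*-Solver
  k = suc k′

  surplus : Fin 3 → ℕ
  surplus zero             = 876 * (k * k) + 594 * k + 600
  surplus (suc zero)       = 1734 * (k * k) + 2366 * k + 596
  surplus (suc (suc zero)) = 2520 * (k * k) + 5262 * k + 588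

  module _ {n} (r : ℕ) (x : Polynomial n) where
    private
      K R Δ Λ M N : Polynomial n
      K = con 1 :+ x
      R = con r
      Δ = x :+ K :+ (K :+ R)
      Λ = K :* K :* (K :+ R)
      M = con 1 :+ (R :* (K :* K) :+ (con 1 :+ (R :+ R) :* (K :* (K :+ R))))
      N = R :* Λ :+ (R :+ R) :* Λ
    equation : ℕ → ℕ → ℕ → Polynomial n × Polynomial n
    equation a b c = (con 1 :+ Δ) :* M :* Δ :+ (con a :* (K :* K) :+ con b :* K :+ con c) :=
                     con 3 :* (N :* Δ :+ con 100 :* M)

  identity : ∀ r → let open Parameters k′ (suc (toℕ r)) in
             suc Δ * M * Δ + surplus r ≡ 3 * (N * Δ + 100 * M)
  identity zero             = solve 1 (λ x → equation 1 x 876 594 600) refl k′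
  identity (suc zero)       = solve 1 (λ x → equation 2 x 1734 2366 596) refl k′
  identity (suc (suc zero)) = solve 1 (λ x → equation 3 x 2520 5262 588) refl k′

WitnessFor : (Δ : ℕ) .{{_ : NonZero Δ}} → Set₁
WitnessFor Δ = ∃[ K ] ∀ (A : GreedyAlgorithm) → + suc Δ / 3 - c ℚ.* (+ 1 / Δ) ℚ.≤ ratio A {Δ} K

singleton : Graph
singleton = record
  { order    = 1
  ; _~_      = λ _ _ → ⊥
  ; _~?_     = λ _ _ → no λ ()
  ; ~-sym    = λ ()
  ; ~-irrefl = λ _ ()
  }

witness-bound : ∀ {Δ} .{{_ : NonZero Δ}} (G : Graph) → NonZero (Graph.order G) → MaxDegree≤ G Δ →
  ∀ {N M} → NonZero M → suc Δ * M * Δ ≤ 3 * (N * Δ + 100 * M) →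
  N ≤ α G → (∀ {I} → IsGreedySet G I → ∣ I ∣ ≤ M) → WitnessFor Δ
witness-bound {Δ} G nonempty maxDegree {N} {M} nonZero le N≤α greedy≤M =
  record { graph = G ; nonempty = nonempty ; maxDegree = maxDegree } , λ A →
  let open GreedyAlgorithm A in
  loss-bound Δ (α G) ∣ output G ∣ {{greedy-size-nonZero G nonempty (greedy G)}}
    (clear-denominators {{nonZero}} le N≤α (greedy≤M (greedy G)))

-- For small Δ the left-hand side is at most 0, and any graph will do.
witness-small : ∀ Δ .{{_ : NonZero Δ}} → Δ ≤ 11 → WitnessFor Δ
witness-small Δ Δ≤11 = record { graph = singleton ; nonempty = _ ; maxDegree = λ { zero → z≤n } } , λ A →
  let open GreedyAlgorithm A
      d = ∣ output singleton ∣
  in loss-bound Δ (α singleton) d {{greedy-size-nonZero singleton _ (greedy singleton)}} (begin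
    suc Δ * d * Δ                          ≤⟨ ℕ.*-mono-≤ (ℕ.*-monoˡ-≤ d (s≤s Δ≤11)) Δ≤11 ⟩
    12 * d * 11                            ≡⟨ solve 1 (λ d → con 12 :* d :* con 11 := con 132 :* d) refl d ⟩
    132 * d                                ≤⟨ ℕ.*-monoˡ-≤ d (ℕ.m≤m+n 132 168) ⟩
    300 * d                                ≡⟨ ℕ.*-assoc 3 100 d ⟩
    3 * (100 * d)                          ≤⟨ ℕ.*-monoʳ-≤ 3 (ℕ.m≤n+m (100 * d) (α singleton * Δ)) ⟩
    3 * (α singleton * Δ + 100 * d)        ∎)
  where
  open ℕ.≤-Reasoning
  open +-*-Solver

witness-large : ∀ k′ (r : Fin 3) → 3 ≤ k′ → .{{_ : NonZero (Parameters.Δ k′ (suc (toℕ r)))}} →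
                WitnessFor (Parameters.Δ k′ (suc (toℕ r)))
witness-large k′ r 3≤k′ =
  witness-bound C.badGraph C.badGraph-nonempty C.badGraph-maxDegree {N} {M} _ (surplus-bound k′ r)
    C.badGraph-α≥ C.badGraph-greedySet≤
  where
  open Parameters k′ (suc (toℕ r))
  module C = Construction k′ (suc (toℕ r)) (k * k) (k * (k + suc (toℕ r))) (s≤s z≤n)
               (ℕ.≤-trans (toℕ<n r) 3≤k′) (labels-balanced k (suc (toℕ r)))

witness : ∀ Δ .{{_ : NonZero Δ}} → WitnessFor Δ
witness Δ with Δ ℕ.≤? 11
... | yes Δ≤11 = witness-small Δ Δ≤11
... | no Δ≰11 with ℕ.m≤n⇒∃[o]m+o≡n (ℕ.≰⇒> Δ≰11)
...   | Δ′ , refl with Δ′ divMod 3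
...     | result j r refl = subst (λ n → WitnessFor (suc n)) eq (witness-large (3 + j) r (ℕ.m≤m+n 3 j))
  where
  open +-*-Solver
  eq = solve 2 (λ j r → con 2 :+ j :+ (con 4 :+ j) :+ (con 4 :+ j :+ (con 1 :+ r)) :=
                        con 11 :+ (r :+ j :* con 3)) refl j (toℕ r)

theorem25 :
    ∃[ c ] 0ℚ ℚ.< c ×
      ((Δ : ℕ) .{{_ : NonZero Δ}} (A : GreedyAlgorithm) →
        (+ suc Δ) / 3 - c ℚ.* ((+ 1) / Δ) ≤sup ratio A {Δ})
theorem25 = c , from-yes (0ℚ ℚ.<? c) , λ Δ A q q<x →
  let K , bound = witness Δ in K , ℚ.<-≤-trans q<x (bound A)
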